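{- Consider a position in the incomplete-information deque sorting game in which the output is $1,2,\dots,t$, the deque is not a sandwich state, and a newly revealed input element $x$ must be placed at one end of the deque. The placement of $x$ is a substantive choice if and only if all of the following hold: (1) the deque already contains at least two elements, so that its two end elements are distinct; let $i$ be the smaller and $j$ the larger of the two end elements; (2) $x<i$ (so $x$ is smaller than both end elements); (3) $i-x\ge 3$, i.e. there are at least two values strictly between $x$ and $i$; (4) $x\neq t+1$, i.e. $x$ is not the next element required by the output; (5) some element larger than $i$ has not yet been revealed (is still in the input); (6) if the deque is non-monotonic, then some element $z$ with $i<z<j$ has not yet been revealed.
   Context: Sorting on a deque: the input is a permutation of $\{1,\dots,n\}$; allowed operations are moving the first input element to the left or right end of the deque, and moving the left or right end element of the deque to the end of the output; the goal is the output $1,2,\dots,n$. In the incomplete-information game, input elements are revealed one at a time, and the placement of a revealed element must be decided before any later input element is seen. A deque state is a sandwich state if some element of the deque has a larger element somewhere to its left and a larger element somewhere to its right. The deque is monotonic if its elements read from left to right are increasing or decreasing. Given a position as in the claim, a completion is an ordering of the not-yet-revealed elements as the rest of the input. The placement of $x$ is a substantive choice if there exists a completion which can be sorted (with complete information from then on) after placing $x$ at the end of the deque next to $i$ but not after placing it next to $j$, and also a completion which can be sorted after placing $x$ next to $j$ but not after placing it next to $i$. -}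

module Defs where

open import Data.Nat using (ℕ; suc; _<_; _≤_; _>_; _∸_; _⊓_; _⊔_)
open import Data.List using (List; []; _∷_; _++_; _∷ʳ_; [_]; applyUpTo)
open import Data.List.Relation.Unary.Any using (Any)
open import Data.List.Relation.Unary.Linked using (Linked)
open import Data.List.Relation.Binary.Permutation.Propositional using (_↭_)
open import Data.Product using (Σ; ∃; _×_; _,_)
open import Data.Sum using (_⊎_)
open import Relation.Nullary using (¬_)
open import Relation.Binary.PropositionalEquality using (_≡_; _≢_)
open import Relation.Binary.Construct.Closure.ReflexiveTransitive using (Star)

-- A configuration of deque sorting: (remaining input, deque read left to right,
-- output so far in order).
Config : Set
Config = List ℕ × List ℕ × List ℕ

data Step : Config → Config → Set where
  pushL : ∀ y inp d o → Step (y ∷ inp , d , o) (inp , y ∷ d , o)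
  pushR : ∀ y inp d o → Step (y ∷ inp , d , o) (inp , d ∷ʳ y , o)
  popL  : ∀ y inp d o → Step (inp , y ∷ d , o) (inp , d , o ∷ʳ y)
  popR  : ∀ y inp d o → Step (inp , d ∷ʳ y , o) (inp , d , o ∷ʳ y)

oneTo : ℕ → List ℕ
oneTo n = applyUpTo suc n

Sortable : ℕ → Config → Set
Sortable n c = Star Step c ([] , [] , oneTo n)

Sandwich : List ℕ → Set
Sandwich D = ∃ λ L → ∃ λ y → ∃ λ R →
  (D ≡ L ++ y ∷ R) × Any (y <_) L × Any (y <_) R

Monotonic : List ℕ → Set
Monotonic D = Linked _<_ D ⊎ Linked _>_ D

-- Position: output 1..t, deque D, newly revealed x, unrevealed elements rem
-- (as an unordered collection).  A completion is any ordering c of rem.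
-- The placement of x is a substantive choice: some completion is sortable after
-- putting x at one end but not the other, and vice versa.
SubstantiveChoice : ℕ → ℕ → List ℕ → ℕ → List ℕ → Set
SubstantiveChoice n t D x rem =
  (∃ λ c → (c ↭ rem) × Sortable n (c , x ∷ D , oneTo t)
                     × ¬ Sortable n (c , D ∷ʳ x , oneTo t))
  × (∃ λ c → (c ↭ rem) × Sortable n (c , D ∷ʳ x , oneTo t)
                       × ¬ Sortable n (c , x ∷ D , oneTo t))

Conditions : ℕ → List ℕ → ℕ → List ℕ → Set
Conditions t D x rem = ∃ λ a → ∃ λ b → ∃ λ m →
  (D ≡ a ∷ (m ++ [ b ])) ×
  (x < a ⊓ b) ×
  (3 ≤ (a ⊓ b) ∸ x) ×
  (x ≢ suc t) ×
  Any (λ z → a ⊓ b < z) rem ×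
  (¬ Monotonic D → Any (λ z → (a ⊓ b < z) × (z < a ⊔ b)) rem)

{-# OPTIONS --safe #-}
-- By left-right symmetry let a < b be the left and right ends of D.  An element that has
-- larger elements on both sides can never leave the deque, so a ≤ x would force x next to b.
-- For x < a, compare the two placements by mirroring: turning the block D around inside
-- L ++ D ++ R preserves sortability as long as everything pushed around D is smaller than a,
-- because when D starts to be popped nothing else is left in the deque.  If one of the
-- conditions (3), (5), (6) fails, a pending element above a cannot be pushed too early, hence
-- x ∷ D is at least as good as D ∷ʳ x; if (4) fails, x is output at once from either end.
--
-- Conversely let w be a pending element above a, and below b unless D is monotonic.
-- Revealing w first, and the rest in increasing order, is sortable only from x ∷ D.
-- Revealing x + 2, t + 1, …, x - 1, w, and then the rest in increasing order is sortable
-- only from D ∷ʳ x: there x + 2 goes next to a and w next to b, whereas from x ∷ D the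
-- element x + 2 must go next to b and then blocks w until x + 1 has come.
module Submission where

open import Defs
open import Data.Empty using (⊥; ⊥-elim)
open import Data.Nat using (ℕ; zero; suc; _+_; _∸_; _≤_; _<_; _⊓_; _⊔_; s≤s; z≤n; _≤?_; _<?_; _≟_)
open import Data.Nat.Properties
open import Data.List using (List; []; _∷_; _++_; _∷ʳ_; [_]; applyUpTo; length; reverse; initLast; _∷ʳ′_)
open import Data.List.Properties
open import Data.List.Membership.Propositional using (_∈_; find; lose)
open import Data.List.Membership.Propositional.Properties
  using (∈-++⁺ˡ; ∈-++⁺ʳ; ∈-++⁻; ∈-∃++)
open import Data.List.Relation.Binary.Permutation.Propositional
  using (_↭_; prep; swap; ↭-refl; ↭-reflexive; ↭-sym; ↭-trans; ↭⇒↭ₛ)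
open import Data.List.Relation.Binary.Permutation.Propositional.Properties
  using (∈-resp-↭; All-resp-↭; ↭-empty-inv; ↭-length; shift; drop-∷; ↭-reverse)
import Data.List.Relation.Binary.Permutation.Propositional.Properties as Perm
open import Data.List.Relation.Binary.Sublist.Propositional
  using (_⊆_; []; _∷_; ⊆-refl; ⊆-trans; minimum; from∈; to∈)
  renaming (_∷ʳ_ to skip)
open import Data.List.Relation.Binary.Sublist.Propositional.Properties
  using (++⁺; ++⁺ˡ; ++⁺ʳ; ∷ˡ⁻; reverse⁺)
open import Data.List.Relation.Unary.All as All using (All; []; _∷_)
import Data.List.Relation.Unary.All.Properties as All
open import Data.List.Relation.Unary.AllPairs as AllPairs using (AllPairs; []; _∷_)
import Data.List.Relation.Unary.AllPairs.Properties as AllPairs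
open import Data.List.Relation.Unary.Any as Any using (Any; here; there)
open import Data.List.Relation.Unary.Linked using (Linked; []; [-]; _∷_; linked?)
open import Data.List.Relation.Unary.Linked.Properties using (Linked⇒AllPairs; AllPairs⇒Linked)
open import Data.Product using (∃; ∃₂; _×_; _,_; proj₁; proj₂)
open import Data.Sum using (_⊎_; inj₁; inj₂)
open import Function using (_∘_; flip)
open import Function.Bundles using (_⇔_; mk⇔; Equivalence)
open import Relation.Binary.Construct.Closure.ReflexiveTransitive using (Star; ε; _◅_)
open import Relation.Binary.Definitions using (tri<; tri≈; tri>)
open import Relation.Binary.PropositionalEquality
  using (_≡_; _≢_; refl; sym; trans; cong; subst; subst₂; setoid)
open import Relation.Nullary using (¬_; yes; no)
open import Relation.Nullary.Decidable using (_⊎-dec_; _×-dec_)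
open import Data.List.Relation.Binary.Permutation.Setoid.Properties (setoid ℕ)
  using (Unique-resp-↭)

-- Runs with the output determined by its length

private
  variable
    n t k x y z p q a b w : ℕ
    d d′ c c′ o o′ L R xs ys r : List ℕ

-- Since the output has to become 1, 2, …, n, it is determined by its length t,
-- and only t + 1 may be popped.  The indices are free variables so that runs can
-- be analysed from deques of any shape.
data Sorts (n : ℕ) (t : ℕ) (d c : List ℕ) : Set where
  done  : t ≡ n → d ≡ [] → c ≡ [] → Sorts n t d c
  pushL : c ≡ y ∷ c′ → Sorts n t (y ∷ d) c′ → Sorts n t d c
  pushR : c ≡ y ∷ c′ → Sorts n t (d ∷ʳ y) c′ → Sorts n t d c
  popL  : d ≡ suc t ∷ d′ → Sorts n (suc t) d′ c → Sorts n t d c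
  popR  : d ≡ d′ ∷ʳ suc t → Sorts n (suc t) d′ c → Sorts n t d c

oneTo-∷ʳ : ∀ t → oneTo t ∷ʳ suc t ≡ oneTo (suc t)
oneTo-∷ʳ = applyUpTo-∷ʳ suc

applyUpTo-prefix : ∀ (f : ℕ → ℕ) t n → applyUpTo f n ≡ applyUpTo f t ++ y ∷ ys → y ≡ f t
applyUpTo-prefix f zero    (suc n) eq = sym (∷-injectiveˡ eq)
applyUpTo-prefix f (suc t) (suc n) eq = applyUpTo-prefix (f ∘ suc) t n (∷-injectiveʳ eq)
applyUpTo-prefix f zero    zero ()
applyUpTo-prefix f (suc t) zero ()

output-extends : Star Step (c , d , o) (c′ , d′ , o′) → ∃ λ s → o′ ≡ o ++ s
output-extends ε = [] , sym (++-identityʳ _)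
output-extends (pushL _ _ _ _ ◅ ss) = output-extends ss
output-extends (pushR _ _ _ _ ◅ ss) = output-extends ss
output-extends (popL y _ _ o ◅ ss) with s , eq ← output-extends ss =
  y ∷ s , trans eq (++-assoc o [ y ] s)
output-extends (popR y _ _ o ◅ ss) with s , eq ← output-extends ss =
  y ∷ s , trans eq (++-assoc o [ y ] s)

-- Output is never retracted, so `y` keeps index `t` in the final list 1, 2, ..., n.
popped : ∀ t n → o ≡ oneTo t → Star Step (c , d , o ∷ʳ y) ([] , [] , oneTo n) →
         (y ≡ suc t) × (o ∷ʳ y ≡ oneTo (suc t))
popped {o = o} {y = y} t n refl ss with s , eq ← output-extends ss
  with refl ← applyUpTo-prefix suc t n (trans eq (++-assoc o [ y ] s))
  = refl , oneTo-∷ʳ t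

Star⇒Sorts : o ≡ oneTo t → Star Step (c , d , o) ([] , [] , oneTo n) → Sorts n t d c
Star⇒Sorts {t = t} {n = n} eq ε =
  done (trans (sym (length-applyUpTo suc t)) (trans (sym (cong length eq)) (length-applyUpTo suc n)))
       refl refl
Star⇒Sorts eq (pushL _ _ _ _ ◅ ss) = pushL refl (Star⇒Sorts eq ss)
Star⇒Sorts eq (pushR _ _ _ _ ◅ ss) = pushR refl (Star⇒Sorts eq ss)
Star⇒Sorts {t = t} {n = n} eq (popL _ _ _ _ ◅ ss) with refl , eq′ ← popped t n eq ss =
  popL refl (Star⇒Sorts eq′ ss)
Star⇒Sorts {t = t} {n = n} eq (popR _ _ _ _ ◅ ss) with refl , eq′ ← popped t n eq ss =
  popR refl (Star⇒Sorts eq′ ss)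

Sorts⇒Star : Sorts n t d c → Sortable n (c , d , oneTo t)
Sorts⇒Star (done refl refl refl) = ε
Sorts⇒Star (pushL refl s) = pushL _ _ _ _ ◅ Sorts⇒Star s
Sorts⇒Star (pushR refl s) = pushR _ _ _ _ ◅ Sorts⇒Star s
Sorts⇒Star {n = n} {t} {c = c} (popL {d′ = d′} refl s) = popL _ _ _ _ ◅
  subst (λ o → Sortable n (c , d′ , o)) (sym (oneTo-∷ʳ t)) (Sorts⇒Star s)
Sorts⇒Star {n = n} {t} {c = c} (popR {d′ = d′} refl s) = popR _ _ _ _ ◅
  subst (λ o → Sortable n (c , d′ , o)) (sym (oneTo-∷ʳ t)) (Sorts⇒Star s)

-- Invariants of sortable deques

∈-∷ʳ : ∀ xs → y ∈ xs ∷ʳ y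
∈-∷ʳ xs = ∈-++⁺ʳ xs (here refl)

-- What is in the deque has yet to be popped, and pops go upwards from `t + 1`.
Sorts⇒t<deque : Sorts n t d c → y ∈ d → t < y
Sorts⇒t<deque (done _ refl _) ()
Sorts⇒t<deque (pushL _ s) m = Sorts⇒t<deque s (there m)
Sorts⇒t<deque (pushR _ s) m = Sorts⇒t<deque s (∈-++⁺ˡ m)
Sorts⇒t<deque (popL refl s) (here refl) = ≤-refl
Sorts⇒t<deque (popL refl s) (there m) = <⇒≤ (Sorts⇒t<deque s m)
Sorts⇒t<deque (popR {d′ = d′} refl s) m with ∈-++⁻ d′ m
... | inj₁ m′ = <⇒≤ (Sorts⇒t<deque s m′)
... | inj₂ (here refl) = ≤-refl

Sorts⇒t<input : Sorts n t d c → y ∈ c → t < y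
Sorts⇒t<input (done _ _ refl) ()
Sorts⇒t<input (pushL refl s) (here refl) = Sorts⇒t<deque s (here refl)
Sorts⇒t<input (pushL refl s) (there m) = Sorts⇒t<input s m
Sorts⇒t<input {d = d} (pushR refl s) (here refl) = Sorts⇒t<deque s (∈-∷ʳ d)
Sorts⇒t<input (pushR refl s) (there m) = Sorts⇒t<input s m
Sorts⇒t<input (popL _ s) m = <⇒≤ (Sorts⇒t<input s m)
Sorts⇒t<input (popR _ s) m = <⇒≤ (Sorts⇒t<input s m)

⊆-snoc : ∀ y → xs ⊆ d → xs ⊆ d ∷ʳ y
⊆-snoc y = ++⁺ʳ [ y ]

∈-⊆ : xs ⊆ ys → y ∈ xs → y ∈ ys
∈-⊆ xs⊆ys m = to∈ (⊆-trans (from∈ m) xs⊆ys)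

snoc-⊆ : ∀ d → xs ∷ʳ z ⊆ d ∷ʳ y → (xs ∷ʳ z ⊆ d) ⊎ (xs ⊆ d × z ≡ y)
snoc-⊆ {[]} [] (refl ∷ _) = inj₂ ([] , refl)
snoc-⊆ {_ ∷ []} [] (_ ∷ ())
snoc-⊆ {_ ∷ _ ∷ _} [] (_ ∷ ())
snoc-⊆ {[]} [] (skip _ ())
snoc-⊆ {_ ∷ _} [] (skip _ ())
snoc-⊆ {[]} (_ ∷ d) (refl ∷ s) = inj₁ (refl ∷ minimum d)
snoc-⊆ {_ ∷ _} (_ ∷ d) (refl ∷ s) with snoc-⊆ d s
... | inj₁ s′ = inj₁ (refl ∷ s′)
... | inj₂ (s′ , e) = inj₂ (refl ∷ s′ , e)
snoc-⊆ (e ∷ d) (skip _ s) with snoc-⊆ d s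
... | inj₁ s′ = inj₁ (skip e s′)
... | inj₂ (s′ , e′) = inj₂ (skip e s′ , e′)

-- Sublists make the pattern stable under pushes. For distinct elements the weak inequalities amount
-- to strict ones.
NoSandwich : List ℕ → Set
NoSandwich d = ∀ {p y q} → p ∷ y ∷ [ q ] ⊆ d → y ≤ p → y ≤ q → ⊥

-- The deque has to become empty, so one of `p` and `q` is popped while `y` stays; the popped value
-- is then smaller than `y`.
Sorts⇒NoSandwich : Sorts n t d c → NoSandwich d
Sorts⇒NoSandwich (done _ refl _) ()
Sorts⇒NoSandwich (pushL _ s) e = Sorts⇒NoSandwich s (skip _ e)
Sorts⇒NoSandwich (pushR _ s) e = Sorts⇒NoSandwich s (⊆-snoc _ e)
Sorts⇒NoSandwich (popL refl s) (skip _ e) = Sorts⇒NoSandwich s e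
Sorts⇒NoSandwich (popL refl s) (refl ∷ e) y≤p _ =
  <⇒≱ (Sorts⇒t<deque s (∈-⊆ e (here refl))) y≤p
Sorts⇒NoSandwich (popR {d′ = d′} refl s) {p} {y} {q} e y≤p y≤q
  with snoc-⊆ {xs = p ∷ [ y ]} d′ e
... | inj₁ e′ = Sorts⇒NoSandwich s e′ y≤p y≤q
... | inj₂ (e′ , refl) = <⇒≱ (Sorts⇒t<deque s (∈-⊆ e′ (there (here refl)))) y≤q

Sorts-reverse : Sorts n t d c → Sorts n t (reverse d) c
Sorts-reverse (done e refl e′) = done e refl e′
Sorts-reverse {n = n} {t} {d} (pushL {y} {c′} e s) =
  pushR e (subst (λ d → Sorts n t d c′) (unfold-reverse y d) (Sorts-reverse s))
Sorts-reverse {n = n} {t} {d} (pushR {y} {c′} e s) =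
  pushL e (subst (λ d → Sorts n t d c′) (reverse-++ d [ y ]) (Sorts-reverse s))
Sorts-reverse (popL {d′} refl s) = popR (unfold-reverse _ d′) (Sorts-reverse s)
Sorts-reverse (popR {d′} refl s) = popL (reverse-++ d′ [ _ ]) (Sorts-reverse s)

data LastView (y : ℕ) (d L M : List ℕ) : List ℕ → Set where
  in-right : ∀ R → d ≡ L ++ M ++ R → LastView y d L M (R ∷ʳ y)
  in-rest  : L ++ M ≡ d ∷ʳ y → LastView y d L M []

lastView : ∀ L M R → L ++ M ++ R ≡ d ∷ʳ y → LastView y d L M R
lastView {d} {y} L M R eq with initLast R
... | [] = in-rest (trans (cong (L ++_) (sym (++-identityʳ M))) eq)
... | R′ ∷ʳ′ z
  with e , refl ← ∷ʳ-injective (L ++ M ++ R′) d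
         (trans (trans (++-assoc L (M ++ R′) [ z ]) (cong (L ++_) (++-assoc M R′ [ z ]))) eq)
  = in-right R′ (sym e)

-- `t + 1` must be the next output, so only pushes precede its pop, and they can equally be made
-- after it is gone.
Sorts-pop-next : ∀ L R → d ≡ L ++ suc t ∷ R → Sorts n t d c → Sorts n (suc t) (L ++ R) c
Sorts-pop-next L R refl (done _ e _) with L | e
... | [] | ()
... | _ ∷ _ | ()
Sorts-pop-next L R refl (pushL e s) = pushL e (Sorts-pop-next (_ ∷ L) R refl s)
Sorts-pop-next {t = t} {n = n} L R refl (pushR {y} {c′} e s) =
  pushR e (subst (λ d → Sorts n _ d c′) (sym (++-assoc L R [ y ]))
    (Sorts-pop-next L (R ∷ʳ y) (++-assoc L (suc t ∷ R) [ y ]) s))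
Sorts-pop-next [] R refl (popL refl s) = s
-- A second copy of `t + 1` would stay behind in the deque.
Sorts-pop-next (_ ∷ L) R refl (popL refl s) =
  ⊥-elim (<-irrefl refl (Sorts⇒t<deque s (∈-++⁺ʳ L (here refl))))
Sorts-pop-next {t = t} L R refl (popR eq s) with lastView L [ suc t ] R eq
... | in-right R′ refl = ⊥-elim (<-irrefl refl (Sorts⇒t<deque s (∈-++⁺ʳ L (here refl))))
... | in-rest e with refl , _ ← ∷ʳ-injective L _ e rewrite ++-identityʳ L = s


-- Turning a block around inside the deque

-- `near`: only t + 1 can lie outside the block.  `between x`: as long as x is in
-- the deque, an input element above a cannot be placed, and its release leads to
-- `near`.  `high`: an input element above a cannot be placed while b is in the deque.
data Guard (a b : ℕ) (m R : List ℕ) (t : ℕ) (c : List ℕ) : Set where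
  near    : a ≤ 2 + t → Guard a b m R t c
  between : x ∈ R → x < a → a ≤ 2 + x → Guard a b m R t c
  high    : All (λ y → y < a ⊎ (b ≤ y × Any (b ≤_) (a ∷ m))) c → Guard a b m R t c

module Block (a b : ℕ) (m : List ℕ) (a<b : a < b) where

  D : List ℕ
  D = a ∷ m ++ [ b ]

  ends⊆D : a ∷ [ b ] ⊆ D
  ends⊆D = refl ∷ ++⁺ˡ m ⊆-refl

  outside-empty : All (_< a) L → (∀ {y} → y ∈ L → t < y) → a ≤ suc t → L ≡ []
  outside-empty [] _ _ = refl
  outside-empty (l<a ∷ _) t<L a≤1+t = ⊥-elim (<⇒≱ l<a (≤-trans a≤1+t (t<L (here refl))))

  flip-bare : Sorts n t (D ++ []) c → Sorts n t (reverse D ++ []) c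
  flip-bare {n} {t} {c} s =
    subst (λ d → Sorts n t d c) (sym (++-identityʳ (reverse D)))
      (Sorts-reverse (subst (λ d → Sorts n t d c) (++-identityʳ D) s))

  -- No value lies strictly between `t` and `a`, so the deque is the block alone and can be
  -- reflected as a whole.
  flip-last : ∀ L R → All (_< a) L → All (_< a) R → a ≤ suc t →
              Sorts n t (L ++ D ++ R) c → Sorts n t (L ++ reverse D ++ R) c
  flip-last L R L<a R<a a≤1+t s
    with refl ← outside-empty L<a (Sorts⇒t<deque s ∘ ∈-++⁺ˡ) a≤1+t
    with refl ← outside-empty R<a (Sorts⇒t<deque s ∘ ∈-++⁺ʳ D) a≤1+t
    = flip-bare s

  -- Outside the block only `t + 1` is possible. If present, it is output at once from its end,
  -- which leaves the block alone.
  flip-near : ∀ L R → All (_< a) L → All (_< a) R → a ≤ 2 + t →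
              Sorts n t (L ++ D ++ R) c → Sorts n t (L ++ reverse D ++ R) c
  flip-near (l ∷ L) R (l<a ∷ L<a) R<a a≤2+t s
    with refl ← ≤-antisym (Sorts⇒t<deque s (here refl)) (≤-pred (≤-trans l<a a≤2+t))
    = popL refl (flip-last L R L<a R<a a≤2+t (Sorts-pop-next [] (L ++ D ++ R) refl s))
  flip-near {t = t} {n = n} {c = c} [] R _ R<a a≤2+t s with initLast R
  ... | [] = flip-bare s
  ... | R′ ∷ʳ′ r
    with r<a ∷ [] ← All.++⁻ʳ R′ R<a
    with refl ← ≤-antisym (Sorts⇒t<deque s (∈-++⁺ʳ D (∈-∷ʳ R′))) (≤-pred (≤-trans r<a a≤2+t))
    = popR (sym (++-assoc (reverse D) R′ [ r ]))
        (flip-last [] R′ [] (All.++⁻ˡ R′ R<a) a≤2+t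
          (subst (λ d → Sorts n (suc t) d c) (++-identityʳ (D ++ R′))
            (Sorts-pop-next (D ++ R′) [] (sym (++-assoc D R′ [ r ])) s)))

  snoc-assoc : ∀ L M R → (L ++ M ++ R) ∷ʳ y ≡ L ++ M ++ (R ∷ʳ y)
  snoc-assoc {y} L M R = trans (++-assoc L (M ++ R) [ y ]) (cong (L ++_) (++-assoc M R [ y ]))

  -- `a` would be shut in between `y` and `b`.
  left-blocked : ∀ L R → a ≤ y → ¬ Sorts n t (y ∷ L ++ D ++ R) c
  left-blocked L R a≤y s =
    Sorts⇒NoSandwich s (refl ∷ ++⁺ˡ L (++⁺ʳ R ends⊆D)) a≤y (<⇒≤ a<b)

  b⊆D : [ b ] ⊆ D
  b⊆D = ∷ˡ⁻ ends⊆D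

  -- `x` would be shut in between `b` and `y`.
  between-blocked : ∀ L R → x ∈ R → x < a → a ≤ y → ¬ Sorts n t ((L ++ D ++ R) ∷ʳ y) c
  between-blocked {x} {y} L R x∈R x<a a≤y s =
    Sorts⇒NoSandwich s (++⁺ (++⁺ˡ L (++⁺ b⊆D (from∈ x∈R))) (⊆-refl {x = [ y ]}))
      (<⇒≤ (<-trans x<a a<b)) (≤-trans (<⇒≤ x<a) a≤y)

  -- `b` would be shut in between `y` and an element of `a ∷ m` that is at least `b`.
  high-blocked : ∀ L R → b ≤ y → Any (b ≤_) (a ∷ m) → ¬ Sorts n t ((L ++ D ++ R) ∷ʳ y) c
  high-blocked {y} L R b≤y big s with p , p∈ , b≤p ← find big =
    Sorts⇒NoSandwich s
      (++⁺ (++⁺ˡ L (++⁺ʳ R (++⁺ (from∈ p∈) (⊆-refl {x = [ b ]})))) (⊆-refl {x = [ y ]})) b≤p b≤y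

  guard-tail : Guard a b m R t (y ∷ c) → Guard a b m R t c
  guard-tail (near p) = near p
  guard-tail (between p q r) = between p q r
  guard-tail (high (_ ∷ h)) = high h

  guard-snoc : Guard a b m R t c → Guard a b m (R ∷ʳ y) t c
  guard-snoc (near p) = near p
  guard-snoc (between p q r) = between (∈-++⁺ˡ p) q r
  guard-snoc (high h) = high h

  guard-suc : Guard a b m R t c → Guard a b m R (suc t) c
  guard-suc (near p) = near (m≤n⇒m≤1+n p)
  guard-suc (between p q r) = between p q r
  guard-suc (high h) = high h

  guard-pop : ∀ R → Guard a b m (R ∷ʳ suc t) t c → Guard a b m R (suc t) c
  guard-pop R (near p) = near (m≤n⇒m≤1+n p)
  guard-pop R (between p q r) with ∈-++⁻ R p
  ... | inj₁ p′ = between p′ q r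
  -- Here `x` itself leaves, so `x` is `t + 1` and `a ≤ 2 + x` is the bound for `near`.
  ... | inj₂ (here refl) = near r
  guard-pop R (high h) = high h

  left-guarded : ∀ L R → Guard a b m R t (y ∷ c) → 2 + t < a →
                 Sorts n t (y ∷ L ++ D ++ R) c → y < a
  left-guarded {y = y} L R _ _ s with y <? a
  ... | yes y<a = y<a
  ... | no y≮a = ⊥-elim (left-blocked L R (≮⇒≥ y≮a) s)

  right-guarded : ∀ L R → Guard a b m R t (y ∷ c) → 2 + t < a →
                  Sorts n t ((L ++ D ++ R) ∷ʳ y) c → y < a
  right-guarded {y = y} L R g far s with y <? a | g
  ... | yes y<a | _ = y<a
  ... | no y≮a | near p = ⊥-elim (<⇒≱ far p)
  ... | no y≮a | between p q _ = ⊥-elim (between-blocked L R p q (≮⇒≥ y≮a) s)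
  ... | no y≮a | high (inj₁ y<a ∷ _) = y<a
  ... | no y≮a | high (inj₂ (b≤y , big) ∷ _) = ⊥-elim (high-blocked L R b≤y big s)

  -- While `a > 2 + t` no pop touches the block and the guard keeps pushed elements below `a`, so
  -- the run is copied move by move around the reversed block. After that `flip-near` applies.
  Sorts-flip : ∀ L R → d ≡ L ++ D ++ R → All (_< a) L → All (_< a) R → Guard a b m R t c →
               Sorts n t d c → Sorts n t (L ++ reverse D ++ R) c
  Sorts-flip {t = t} L R eq L<a R<a g s with a ≤? 2 + t
  Sorts-flip L R refl L<a R<a g s | yes a≤2+t = flip-near L R L<a R<a a≤2+t s
  Sorts-flip [] R refl L<a R<a g (done _ () _) | no _
  Sorts-flip (_ ∷ _) R refl L<a R<a g (done _ () _) | no _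
  Sorts-flip L R refl L<a R<a g (pushL refl s) | no far =
    pushL refl (Sorts-flip (_ ∷ L) R refl (left-guarded L R g (≰⇒> far) s ∷ L<a) R<a
                 (guard-tail g) s)
  Sorts-flip {c = c} {n = n} L R refl L<a R<a g (pushR refl s) | no far =
    pushR refl (subst (λ d → Sorts n _ d _) (sym (snoc-assoc L (reverse D) R))
      (Sorts-flip L (R ∷ʳ _) (snoc-assoc L D R) L<a
        (All.++⁺ R<a (right-guarded L R g (≰⇒> far) s ∷ [])) (guard-snoc (guard-tail g)) s))
  Sorts-flip [] R refl L<a R<a g (popL refl s) | no far = ⊥-elim (far (n≤1+n _))
  Sorts-flip (_ ∷ L) R refl (_ ∷ L<a) R<a g (popL refl s) | no far =
    popL refl (Sorts-flip L R refl L<a R<a (guard-suc g) s)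
  Sorts-flip {t = t} L R refl L<a R<a g (popR eq s) | no far with lastView L D R eq
  ... | in-right R′ eq′ =
    popR (sym (snoc-assoc L (reverse D) R′))
      (Sorts-flip L R′ eq′ L<a (All.++⁻ˡ R′ R<a) (guard-pop R′ g) s)
  ... | in-rest e with _ , refl ← ∷ʳ-injective (L ++ a ∷ m) _ (trans (++-assoc L (a ∷ m) [ b ]) e) =
    ⊥-elim (far (≤-trans (<⇒≤ a<b) (n≤1+n _)))

-- Intervals and completions in increasing order

range : ℕ → ℕ → List ℕ
range t zero    = []
range t (suc k) = suc t ∷ range (suc t) k

oneTo-split : ∀ t k → oneTo (t + k) ≡ oneTo t ++ range t k
oneTo-split t zero = trans (cong oneTo (+-identityʳ t)) (sym (++-identityʳ (oneTo t)))
oneTo-split t (suc k) = trans (cong oneTo (+-suc t k)) (trans (oneTo-split (suc t) k)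
  (trans (cong (_++ range (suc t) k) (sym (oneTo-∷ʳ t))) (∷ʳ-++ (oneTo t) (suc t) _)))

∈-range⁻ : ∀ k → y ∈ range t k → t < y × y ≤ t + k
∈-range⁻ {t = t} (suc k) (here refl) = ≤-refl , m<m+n t (s≤s z≤n)
∈-range⁻ {y} {t} (suc k) (there y∈) with t<y , y≤ ← ∈-range⁻ k y∈ =
  <⇒≤ t<y , subst (y ≤_) (sym (+-suc t k)) y≤

∈-range⁺ : ∀ k → t < y → y ≤ t + k → y ∈ range t k
∈-range⁺ {t} {y} zero t<y y≤ = ⊥-elim (<⇒≱ t<y (subst (y ≤_) (+-identityʳ t) y≤))
∈-range⁺ {t} {y} (suc k) t<y y≤ with suc t ≟ y
... | yes refl = here refl
... | no 1+t≢y = there (∈-range⁺ k (≤∧≢⇒< t<y 1+t≢y) (subst (y ≤_) (+-suc t k) y≤))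

range-increasing : ∀ t k → AllPairs _<_ (range t k)
range-increasing t zero = []
range-increasing t (suc k) =
  All.tabulate (proj₁ ∘ ∈-range⁻ k) ∷ range-increasing (suc t) k

++-cancelˡ-↭ : ∀ xs → xs ++ ys ↭ xs ++ r → ys ↭ r
++-cancelˡ-↭ [] p = p
++-cancelˡ-↭ (_ ∷ xs) p = ++-cancelˡ-↭ xs (drop-∷ p)

NoSandwich-⊆ : xs ⊆ ys → NoSandwich ys → NoSandwich xs
NoSandwich-⊆ xs⊆ys ns e = ns (⊆-trans e xs⊆ys)

NoSandwich-∷ : All (x <_) d → NoSandwich d → NoSandwich (x ∷ d)
NoSandwich-∷ _ ns (skip _ e) = ns e
NoSandwich-∷ x<d _ (refl ∷ e) y≤x _ = <⇒≱ (All.lookup x<d (∈-⊆ e (here refl))) y≤x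

remove-middle : ∀ L R → (L ++ y ∷ R) ++ r ↭ y ∷ (L ++ R) ++ r
remove-middle {y} {r} L R = Perm.++⁺ʳ r (shift y L R)

remove-middleʳ : ∀ d L R → d ++ L ++ y ∷ R ↭ y ∷ d ++ L ++ R
remove-middleʳ {y} d L R = ↭-trans (Perm.++⁺ˡ d (shift y L R)) (shift y d (L ++ R))

-- The witness c reveals the pending elements in increasing order.
sortable-completion : ∀ k t d r → t + k ≡ n → NoSandwich d → d ++ r ↭ range t k →
                      ∃ λ c → c ↭ r × Sorts n t d c
sortable-completion zero t [] r t≡n ns p with refl ← ↭-empty-inv p =
  [] , ↭-refl , done (trans (sym (+-identityʳ t)) t≡n) refl refl
sortable-completion zero t (_ ∷ d) r t≡n ns p with () ← ↭-empty-inv p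
sortable-completion {n} (suc k) t d r t+k≡n ns p
  with ∈-++⁻ d (∈-resp-↭ (↭-sym p) (here refl))
-- A pending `t + 1` is revealed now and passes straight through the deque.
... | inj₂ t∈r with r₁ , r₂ , refl ← ∈-∃++ t∈r
  with c , c↭ , s ← sortable-completion k (suc t) d (r₁ ++ r₂) (trans (sym (+-suc t k)) t+k≡n) ns
         (drop-∷ (↭-trans (↭-sym (remove-middleʳ d r₁ r₂)) p))
  = suc t ∷ c , ↭-trans (prep _ c↭) (↭-sym (shift _ r₁ r₂)) , pushL refl (popL refl s)
... | inj₁ t∈d with L , R , refl ← ∈-∃++ t∈d
  with c , c↭ , s ← sortable-completion k (suc t) (L ++ R) r (trans (sym (+-suc t k)) t+k≡n)
         (NoSandwich-⊆ (++⁺ (⊆-refl {x = L}) (skip _ ⊆-refl)) ns)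
         (drop-∷ (↭-trans (↭-sym (remove-middle L R)) p))
  = c , c↭ , at-end L R ns (λ y∈ → proj₁ (∈-range⁻ (suc k) (∈-resp-↭ p (∈-++⁺ˡ y∈)))) s
  where
  -- The least element of the deque would be sandwiched anywhere but at an end.
  at-end : ∀ L R → NoSandwich (L ++ suc t ∷ R) → (∀ {y} → y ∈ L ++ suc t ∷ R → t < y) →
           Sorts n (suc t) (L ++ R) c → Sorts n t (L ++ suc t ∷ R) c
  at-end [] R ns t< s = popL refl s
  at-end (l ∷ L) [] ns t< s =
    popR refl (subst (λ d → Sorts n (suc t) d c) (++-identityʳ (l ∷ L)) s)
  at-end (l ∷ L) (r ∷ R) ns t< s =
    ⊥-elim (ns (refl ∷ ++⁺ˡ L (refl ∷ refl ∷ minimum R)) (t< (here refl))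
               (t< (there (∈-++⁺ʳ L (there (here refl))))))

-- The witness us is t + 1, …, u.
flush-below : ∀ {u} j k t e r → t + j ≡ u → e ++ r ↭ range t (j + k) → All (u <_) e →
              ∃₂ λ us r′ → us ++ r′ ↭ r × e ++ r′ ↭ range u k ×
                (∀ {d c} → Sorts n u d c → Sorts n t d (us ++ c))
flush-below zero k t e r t≡u p u<e with refl ← trans (sym (+-identityʳ t)) t≡u =
  [] , r , ↭-refl , p , λ s → s
flush-below (suc j) k t e r t+j≡u p u<e with ∈-++⁻ e (∈-resp-↭ (↭-sym p) (here refl))
... | inj₁ t∈e = ⊥-elim (<⇒≱ (All.lookup u<e t∈e)
        (subst (suc t ≤_) (trans (sym (+-suc t j)) t+j≡u) (s≤s (m≤m+n t j))))
... | inj₂ t∈r with r₁ , r₂ , refl ← ∈-∃++ t∈r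
  with us , r′ , us↭ , p′ , run ← flush-below j k (suc t) e (r₁ ++ r₂)
         (trans (sym (+-suc t j)) t+j≡u)
         (drop-∷ (↭-trans (↭-sym (remove-middleʳ e r₁ r₂)) p)) u<e
  = suc t ∷ us , r′ , ↭-trans (prep _ us↭) (↭-sym (shift _ r₁ r₂)) , p′ ,
    λ s → pushL refl (popL refl (run s))

-- While y is still to come after w, none of a, b, z can leave, so w finds both ends blocked.
locked-until-late : ∀ us → c ≡ us ++ w ∷ r → y ∈ r → a ∷ b ∷ [ z ] ⊆ d →
                    y < a → y < b → y < z → a ≤ w → a ≤ b → z ≤ b → z ≤ w → ¬ Sorts n t d c
locked-until-late {w = w} {r} us refl v∈r e v<a v<b v<z a≤w a≤b z≤b z≤w = go us refl e
  where
  v∈ : ∀ us → _ ∈ us ++ w ∷ r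
  v∈ us = ∈-++⁺ʳ us (there v∈r)

  go : ∀ us → c ≡ us ++ w ∷ r → _ ⊆ d → ¬ Sorts n t d c
  go [] refl e (done _ _ ())
  go (_ ∷ _) refl e (done _ _ ())
  -- Pushing `w` on the left shuts in `a`; on the right it shuts in `z`.
  go [] refl e (pushL refl s) =
    Sorts⇒NoSandwich s (refl ∷ ⊆-trans (refl ∷ refl ∷ skip _ []) e) a≤w a≤b
  go [] refl e (pushR refl s) =
    Sorts⇒NoSandwich s (++⁺ (∷ˡ⁻ e) (⊆-refl {x = [ w ]})) z≤b z≤w
  go (_ ∷ us) refl e (pushL refl s) = go us refl (skip _ e) s
  go (_ ∷ us) refl e (pushR refl s) = go us refl (⊆-snoc _ e) s
  go us refl (skip _ e) (popL refl s) = go us refl e s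
  go us refl (refl ∷ e) (popL refl s) = <⇒≱ (Sorts⇒t<input s (v∈ us)) (<⇒≤ v<a)
  go us refl e (popR {d′} refl s) with snoc-⊆ {xs = _ ∷ [ _ ]} d′ e
  ... | inj₁ e′ = go us refl e′ s
  ... | inj₂ (_ , refl) = <⇒≱ (Sorts⇒t<input s (v∈ us)) (<⇒≤ v<z)

-- Sandwich states and monotonicity

AllPairs-lookup : ∀ {R : ℕ → ℕ → Set} → AllPairs R xs → p ∷ [ q ] ⊆ xs → R p q
AllPairs-lookup (_ ∷ rs) (skip _ e) = AllPairs-lookup rs e
AllPairs-lookup (r ∷ _) (refl ∷ e) = All.lookup r (to∈ e)

split-∷ : ∀ {y ys} → y ∷ ys ⊆ d → ∃₂ λ L R → d ≡ L ++ y ∷ R × ys ⊆ R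
split-∷ (skip e s) with L , R , eq , s′ ← split-∷ s = e ∷ L , R , cong (e ∷_) eq , s′
split-∷ (refl ∷ s) = [] , _ , refl , s

-- Distinctness makes the weak inequalities strict.
¬Sandwich⇒NoSandwich : (∀ {p q} → p ∷ [ q ] ⊆ d → p ≢ q) → ¬ Sandwich d → NoSandwich d
¬Sandwich⇒NoSandwich p≢q ¬sw {p} {y} {q} e y≤p y≤q with L , R , refl , e′ ← split-∷ e
  with L′ , R′ , refl , e″ ← split-∷ e′ =
  ¬sw (L ++ p ∷ L′ , y , R′ , sym (++-assoc L (p ∷ L′) (y ∷ R′)) ,
       lose (∈-++⁺ʳ L (here refl))
            (≤∧≢⇒< y≤p (p≢q (⊆-trans (refl ∷ refl ∷ skip q []) e) ∘ sym)) ,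
       lose (to∈ e″) (≤∧≢⇒< y≤q (p≢q (∷ˡ⁻ e))))

-- At a descent the lower element would be shut in between the higher one and `b`.
increasing-below-last : ∀ xs → All (_< b) xs → NoSandwich (xs ∷ʳ b) → Linked _<_ (xs ∷ʳ b)
increasing-below-last [] _ _ = [-]
increasing-below-last (x ∷ []) (x<b ∷ _) _ = x<b ∷ [-]
increasing-below-last (x ∷ y ∷ xs) (x<b ∷ y<b ∷ xs<b) ns =
  ≰⇒> (λ y≤x → ns (refl ∷ refl ∷ ++⁺ˡ xs ⊆-refl) y≤x (<⇒≤ y<b)) ∷
  increasing-below-last (y ∷ xs) (y<b ∷ xs<b) (NoSandwich-⊆ (skip x ⊆-refl) ns)

-- Choices and reflection

Choice : ℕ → ℕ → List ℕ → ℕ → List ℕ → Set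
Choice n t D x rem =
  (∃ λ c → c ↭ rem × Sorts n t (x ∷ D) c × ¬ Sorts n t (D ∷ʳ x) c) ×
  (∃ λ c → c ↭ rem × Sorts n t (D ∷ʳ x) c × ¬ Sorts n t (x ∷ D) c)

SubstantiveChoice⇔Choice : ∀ {D rem} → SubstantiveChoice n t D x rem ⇔ Choice n t D x rem
SubstantiveChoice⇔Choice = mk⇔
  (λ where ((c , p , s , ¬s) , (c′ , p′ , s′ , ¬s′)) →
             (c , p , Star⇒Sorts refl s , ¬s ∘ Sorts⇒Star) ,
             (c′ , p′ , Star⇒Sorts refl s′ , ¬s′ ∘ Sorts⇒Star))
  (λ where ((c , p , s , ¬s) , (c′ , p′ , s′ , ¬s′)) →
             (c , p , Sorts⇒Star s , ¬s ∘ Star⇒Sorts refl) ,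
             (c′ , p′ , Sorts⇒Star s′ , ¬s′ ∘ Star⇒Sorts refl))

Sorts-∷⇒∷ʳreverse : ∀ {D} → Sorts n t (x ∷ D) c → Sorts n t (reverse D ∷ʳ x) c
Sorts-∷⇒∷ʳreverse {n} {t} {x} {c} {D} s =
  subst (λ d → Sorts n t d c) (unfold-reverse x D) (Sorts-reverse s)

Sorts-∷ʳ⇒∷reverse : ∀ {D} → Sorts n t (D ∷ʳ x) c → Sorts n t (x ∷ reverse D) c
Sorts-∷ʳ⇒∷reverse {n} {t} {x} {c} {D} s =
  subst (λ d → Sorts n t d c) (reverse-++ D [ x ]) (Sorts-reverse s)

-- Reflection exchanges the two ends, so the two witnesses trade places.
Choice-reverse : ∀ {D rem} → Choice n t D x rem → Choice n t (reverse D) x rem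
Choice-reverse {n} {t} {x} {D} ((c , p , s , ¬s) , (c′ , p′ , s′ , ¬s′)) =
  (c′ , p′ , Sorts-∷ʳ⇒∷reverse {D = D} s′ ,
    λ r → ¬s′ (subst (λ d → Sorts n t (x ∷ d) c′) (reverse-involutive D) (Sorts-∷ʳ⇒∷reverse {D = reverse D} r))) ,
  (c , p , Sorts-∷⇒∷ʳreverse s ,
    λ r → ¬s (subst (λ d → Sorts n t (d ∷ʳ x) c) (reverse-involutive D) (Sorts-∷⇒∷ʳreverse r)))

-- Here a is the smaller and b the larger end element of D, on whichever side they are.
Criterion : (a b t : ℕ) (D : List ℕ) (x : ℕ) (rem : List ℕ) → Set
Criterion a b t D x rem =
  x < a × 3 ≤ a ∸ x × x ≢ suc t × Any (a <_) rem ×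
  (¬ Monotonic D → Any (λ z → (a < z) × (z < b)) rem)

-- Positions whose left end is the smaller one

module Position
  (n t k a b x : ℕ) (m rem : List ℕ) (a<b : a < b) (t+k≡n : t + k ≡ n)
  (distinct : AllPairs _≢_ ((a ∷ m ++ [ b ]) ++ x ∷ rem)) (ns : NoSandwich (a ∷ m ++ [ b ]))
  (perm : (a ∷ m ++ [ b ]) ++ x ∷ rem ↭ range t k)
  where

  open Block a b m a<b using (D; ends⊆D; Sorts-flip)

  a∉rem : y ∈ rem → y ≢ a
  a∉rem y∈ refl = AllPairs-lookup distinct (refl ∷ ++⁺ˡ (m ++ [ b ]) (skip x (from∈ y∈))) refl

  a≤D : y ∈ D → a ≤ y
  a≤D (here refl) = ≤-refl
  a≤D {y} (there y∈) with ∈-++⁻ m y∈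
  ... | inj₂ (here refl) = <⇒≤ a<b
  ... | inj₁ y∈m = ≮⇒≥ λ y<a →
    ns (refl ∷ ++⁺ (from∈ y∈m) (⊆-refl {x = [ b ]})) (<⇒≤ y<a) (<⇒≤ (<-trans y<a a<b))

  -- Turning `D` around beside `x` and then reflecting the whole deque restores `D` and moves `x` to
  -- the left.
  flip-right : x < a → Guard a b m [ x ] t c → Sorts n t (D ∷ʳ x) c → Sorts n t (x ∷ D) c
  flip-right {c} x<a g s =
    subst (λ d → Sorts n t (x ∷ d) c) (reverse-involutive D)
      (Sorts-∷ʳ⇒∷reverse {D = reverse D} (Sorts-flip [] [ x ] refl [] (x<a ∷ []) g s))

  -- Otherwise `b` exceeds everything before it, and without a sandwich the deque is increasing.
  b-is-large : ¬ Monotonic D → Any (b ≤_) (a ∷ m)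
  b-is-large ¬mono with Any.any? (b ≤?_) (a ∷ m)
  ... | yes big = big
  ... | no small =
    ⊥-elim (¬mono (inj₁ (increasing-below-last (a ∷ m) (All.map ≰⇒> (All.¬Any⇒All¬ _ small)) ns)))

  necessary : Choice n t D x rem → Criterion a b t D x rem
  necessary ((c , p , s , ¬s) , (c′ , p′ , s′ , ¬s′)) =
    x<a , far , x≢1+t , larger , between-ends
    where
    x<a : x < a
    x<a = ≰⇒> λ a≤x → Sorts⇒NoSandwich s (refl ∷ ends⊆D) a≤x (<⇒≤ a<b)

    -- `c′` is sortable only with `x` on the right, so no guard holds for it; `far`, `larger` and
    -- `between-ends` each refute a guard this way.
    no-guard : ¬ Guard a b m [ x ] t c′
    no-guard g = ¬s′ (flip-right x<a g s′)

    far : 3 ≤ a ∸ x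
    far = ≰⇒> λ a∸x≤2 → no-guard (between (here refl) x<a
            (≤-trans (m≤n+m∸n a x) (subst (x + (a ∸ x) ≤_) (+-comm x 2) (+-monoʳ-≤ x a∸x≤2))))

    x≢1+t : x ≢ suc t
    -- `x` would leave at once from either end.
    x≢1+t refl = ¬s (popR refl (Sorts-pop-next [] D refl s))

    larger : Any (a <_) rem
    larger with Any.any? (a <?_) rem
    ... | yes p = p
    ... | no none = ⊥-elim (no-guard (high (All-resp-↭ (↭-sym p′) (All.tabulate λ y∈ →
            inj₁ (≤∧≢⇒< (≮⇒≥ (All.lookup (All.¬Any⇒All¬ _ none) y∈)) (a∉rem y∈))))))

    between-ends : ¬ Monotonic D → Any (λ z → (a < z) × (z < b)) rem
    between-ends ¬mono with Any.any? (λ z → (a <? z) ×-dec (z <? b)) rem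
    ... | yes p = p
    ... | no none = ⊥-elim (no-guard (high (All-resp-↭ (↭-sym p′) (All.tabulate classify))))
      where
      classify : y ∈ rem → y < a ⊎ (b ≤ y × Any (b ≤_) (a ∷ m))
      classify {y} y∈ with y <? a
      ... | yes y<a = inj₁ y<a
      ... | no y≮a = inj₂ (≮⇒≥ (λ y<b → All.lookup (All.¬Any⇒All¬ _ none) y∈
              (≤∧≢⇒< (≮⇒≥ y≮a) (a∉rem y∈ ∘ sym) , y<b)) , b-is-large ¬mono)

  increasing : Monotonic D → AllPairs _<_ D
  increasing (inj₁ inc) = Linked⇒AllPairs <-trans inc
  increasing (inj₂ dec) = ⊥-elim (<-asym a<b
    (AllPairs-lookup (Linked⇒AllPairs (λ p q → <-trans q p) dec) ends⊆D))

  NoSandwich-∷ʳ-increasing : Monotonic D → NoSandwich (D ∷ʳ w)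
  NoSandwich-∷ʳ-increasing mono {p} {y} e y≤p y≤q with snoc-⊆ {xs = p ∷ [ y ]} D e
  ... | inj₁ e′ = ns e′ y≤p y≤q
  ... | inj₂ (e′ , _) = <⇒≱ (AllPairs-lookup (increasing mono) e′) y≤p

  -- Where `w` bounds an element from the right, the larger `b` already did, unless that element is
  -- `b` itself, which exceeds `w`.
  NoSandwich-∷ʳ-below : w < b → NoSandwich (D ∷ʳ w)
  NoSandwich-∷ʳ-below w<b {p} {y} e y≤p y≤q with snoc-⊆ {xs = p ∷ [ y ]} D e
  ... | inj₁ e′ = ns e′ y≤p y≤q
  ... | inj₂ (e′ , refl) with snoc-⊆ {xs = [ p ]} (a ∷ m) e′
  ...   | inj₁ e″ = ns (++⁺ e″ (⊆-refl {x = [ b ]})) y≤p (≤-trans y≤q (<⇒≤ w<b))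
  ...   | inj₂ (_ , refl) = <⇒≱ w<b y≤q

  blocker : Criterion a b t D x rem → ∃ λ w → w ∈ rem × a < w × NoSandwich (D ∷ʳ w)
  blocker (_ , _ , _ , larger , between-ends)
    with linked? _<?_ D ⊎-dec linked? (λ i j → j <? i) D
  ... | yes mono with w , w∈ , a<w ← find larger =
    w , w∈ , a<w , λ {p} → NoSandwich-∷ʳ-increasing mono {p = p}
  ... | no ¬mono with w , w∈ , a<w , w<b ← find (between-ends ¬mono) =
    w , w∈ , a<w , λ {p} → NoSandwich-∷ʳ-below w<b {p = p}

  module Blocked (x<a : x < a) (3+x≤a : 3 + x ≤ a) (x≢1+t : x ≢ suc t)
    (a<w : a < w) (ns-w : NoSandwich (D ∷ʳ w)) (rem↭ : rem ↭ w ∷ r) where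

    t<x : t < x
    t<x = proj₁ (∈-range⁻ k (∈-resp-↭ perm (∈-++⁺ʳ D (here refl))))

    low<all : y < a → All (y <_) (D ∷ʳ w)
    low<all y<a = All.++⁺ (All.tabulate (<-≤-trans y<a ∘ a≤D)) (<-trans y<a a<w ∷ [])

    b-not-next : b ≢ suc t
    b-not-next refl = <⇒≱ (<-trans x<a a<b) t<x

    perm-w : (x ∷ D ∷ʳ w) ++ r ↭ range t k
    perm-w = ↭-trans (prep x (↭-reflexive (∷ʳ-++ D w r)))
      (↭-trans (prep x (Perm.++⁺ˡ D (↭-sym rem↭))) (↭-trans (↭-sym (shift x D rem)) perm))

    left-only : ∃ λ c → c ↭ rem × Sorts n t (x ∷ D) c × ¬ Sorts n t (D ∷ʳ x) c
    left-only
      with c , c↭ , s ← sortable-completion k t (x ∷ D ∷ʳ w) r t+k≡n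
                          (NoSandwich-∷ (low<all x<a) ns-w) perm-w
      = w ∷ c , ↭-trans (prep w c↭) (↭-sym rem↭) , pushR refl s , refute
      where
      refute : ¬ Sorts n t (D ∷ʳ x) (w ∷ c)
      -- Pushing `w` on the left shuts in `a`, on the right `x`; neither `a` nor `x` is `t + 1`.
      refute (pushL refl s) =
        Sorts⇒NoSandwich s (refl ∷ ++⁺ʳ [ x ] ends⊆D) (<⇒≤ a<w) (<⇒≤ a<b)
      refute (pushR refl s) =
        Sorts⇒NoSandwich s (++⁺ (++⁺ (∷ˡ⁻ ends⊆D) (⊆-refl {x = [ x ]})) (⊆-refl {x = [ w ]}))
          (<⇒≤ (<-trans x<a a<b)) (<⇒≤ (<-trans x<a a<w))
      refute (popL refl s) = <⇒≱ x<a t<x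
      refute (popR eq s) with _ , refl ← ∷ʳ-injective D _ eq = x≢1+t refl

    -- A value strictly between `x` and `a` is not in `D`, and it differs from `x` and from `w > a`.
    2+x∈r : 2 + x ∈ r
    2+x∈r with ∈-++⁻ D (∈-resp-↭ (↭-sym perm) (∈-range⁺ k (m≤n⇒m≤1+n (m≤n⇒m≤1+n t<x)) 2+x≤n))
      where
      2+x≤n : 2 + x ≤ t + k
      2+x≤n = ≤-trans (<⇒≤ 3+x≤a) (proj₂ (∈-range⁻ k (∈-resp-↭ perm (here refl))))
    ... | inj₁ z∈D = ⊥-elim (<⇒≱ 3+x≤a (a≤D z∈D))
    ... | inj₂ (here 2+x≡x) = ⊥-elim (m+1+n≢n 1 2+x≡x)
    ... | inj₂ (there z∈rem) with ∈-resp-↭ rem↭ z∈rem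
    ...   | here refl = ⊥-elim (<⇒≱ a<w (<⇒≤ 3+x≤a))
    ...   | there z∈r = z∈r

    x+2 : ℕ
    x+2 = 2 + x

    1+x<middle : All (suc x <_) (x+2 ∷ D ∷ʳ w)
    1+x<middle = ≤-refl ∷ low<all (<⇒≤ 3+x≤a)

    -- Covers the stage where `x` has just left. All of `x+2 ∷ D ∷ʳ w` exceeds `x + 1`, which is
    -- therefore still to come after `w`.
    finish : ∀ {u} k r′ → suc u ≡ x → u + k ≡ n → (x ∷ x+2 ∷ D ∷ʳ w) ++ r′ ↭ range u k →
             ∃ λ c → c ↭ r′ × suc x ∈ c × Sorts n x (x+2 ∷ D ∷ʳ w) c
    finish zero _ _ _ p with () ← ↭-empty-inv p
    finish {u} (suc k) r′ 1+u≡x u+k≡n p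
      with p′ ← drop-∷ (subst (λ v → (x ∷ x+2 ∷ D ∷ʳ w) ++ r′ ↭ v ∷ range v k) 1+u≡x p)
      with c , c↭ , s ← sortable-completion k x (x+2 ∷ D ∷ʳ w) r′
                          (trans (cong (_+ k) (sym 1+u≡x)) (trans (sym (+-suc u k)) u+k≡n))
                          (NoSandwich-∷ (low<all 3+x≤a) ns-w) p′
      = c , c↭ , ∈-resp-↭ (↭-sym c↭) (pending k p′) , s
      where
      pending : ∀ k → (x+2 ∷ D ∷ʳ w) ++ r′ ↭ range x k → suc x ∈ r′
      pending zero p with () ← ↭-empty-inv p
      pending (suc k) p with ∈-++⁻ (x+2 ∷ D ∷ʳ w) (∈-resp-↭ (↭-sym p) (here refl))
      ... | inj₁ 1+x∈ = ⊥-elim (<-irrefl refl (All.lookup 1+x<middle 1+x∈))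
      ... | inj₂ 1+x∈ = 1+x∈

    right-only : ∃ λ c → c ↭ rem × Sorts n t (D ∷ʳ x) c × ¬ Sorts n t (x ∷ D) c
    right-only
      with r₁ , r₂ , r≡ ← ∈-∃++ 2+x∈r
      with r↭ ← ↭-trans (↭-reflexive r≡) (shift x+2 r₁ r₂)
      -- `j` counts the values strictly between `t` and `x`, so `u = t + j` is `x - 1`.
      with j , 1+u≡x ← x ∸ suc t , m+[n∸m]≡n t<x
      with j+k≡ ← m+[n∸m]≡n (+-cancelˡ-≤ t j k (<⇒≤ (subst (_≤ t + k) (sym 1+u≡x)
                    (proj₂ (∈-range⁻ k (∈-resp-↭ perm (∈-++⁺ʳ D (here refl))))))))
      with us , r′ , us↭ , p , run ← flush-below {u = t + j} j (k ∸ j) t (x ∷ x+2 ∷ D ∷ʳ w) (r₁ ++ r₂) refl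
             (subst (λ k → (x ∷ x+2 ∷ D ∷ʳ w) ++ r₁ ++ r₂ ↭ range t k) (sym j+k≡)
               (↭-trans (prep x (↭-trans (↭-sym (shift x+2 (D ∷ʳ w) (r₁ ++ r₂)))
                 (Perm.++⁺ˡ (D ∷ʳ w) (↭-sym r↭)))) perm-w))
             (subst (λ v → All (t + j <_) (v ∷ x+2 ∷ D ∷ʳ w)) 1+u≡x
               (≤-refl ∷ All.map (λ 1+x<y → <-trans (≤-reflexive 1+u≡x) (<⇒≤ 1+x<y)) 1+x<middle))
      with c , c↭ , 1+x∈c , s ← finish (k ∸ j) r′ 1+u≡x
             (trans (+-assoc t j _) (trans (cong (t +_) j+k≡) t+k≡n)) p
      = x+2 ∷ us ++ w ∷ c
      , ↭-trans (prep x+2 (shift w us c))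
          (↭-trans (swap x+2 w (↭-trans (Perm.++⁺ˡ us c↭) us↭))
            (↭-trans (prep w (↭-sym r↭)) (↭-sym rem↭)))
      -- `x + 2` goes left, the values below `x` pass through, `x` leaves on the right, and `w`
      -- takes its place.
      , pushL refl (run (popR (cong (λ v → x+2 ∷ D ∷ʳ v) (sym 1+u≡x))
          (subst (λ v → Sorts n v (x+2 ∷ D) (w ∷ c)) (sym 1+u≡x) (pushR refl s))))
      , refute
      where
      refute : ¬ Sorts n t (x ∷ D) (x+2 ∷ us ++ w ∷ c)
      -- On the left `x + 2` shuts in `x` against `a`; on the right the late `x + 1` holds `a`, `b`
      -- and `x + 2` in place when `w` arrives.
      refute (pushL refl s) =
        Sorts⇒NoSandwich s (refl ∷ refl ∷ refl ∷ minimum _) (m≤n+m x 2) (<⇒≤ x<a)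
      refute (pushR refl s) =
        locked-until-late us refl 1+x∈c (skip x (++⁺ ends⊆D (⊆-refl {x = [ x+2 ]})))
          (<⇒≤ 3+x≤a) (<-trans (<⇒≤ 3+x≤a) a<b) ≤-refl
          (<⇒≤ a<w) (<⇒≤ a<b) (<⇒≤ (<-trans 3+x≤a a<b)) (<⇒≤ (<-trans 3+x≤a a<w)) s
      refute (popL refl s) = x≢1+t refl
      refute (popR eq s) with _ , refl ← ∷ʳ-injective (x ∷ a ∷ m) _ eq = b-not-next refl

  sufficient : Criterion a b t D x rem → Choice n t D x rem
  sufficient crit@(x<a , far , x≢1+t , _)
    with w , w∈ , a<w , ns-w ← blocker crit
    with r₁ , r₂ , refl ← ∈-∃++ w∈
    = left-only , right-only
    where
    3+x≤a : 3 + x ≤ a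
    3+x≤a = subst (3 + x ≤_) (m∸n+n≡m (<⇒≤ x<a)) (+-monoˡ-≤ x far)
    open Blocked x<a 3+x≤a x≢1+t a<w ns-w (shift w r₁ r₂)

-- Reflected positions and the theorem

Linked-reverse : ∀ {R : ℕ → ℕ → Set} → (∀ {i j k} → R i j → R j k → R i k) →
                 Linked R xs → Linked (flip R) (reverse xs)
Linked-reverse {R = R} tr l = AllPairs⇒Linked (go (Linked⇒AllPairs tr l))
  where
  go : ∀ {xs} → AllPairs R xs → AllPairs (flip R) (reverse xs)
  go [] = []
  go {x ∷ xs} (rx ∷ rxs) = subst (AllPairs (flip R)) (sym (unfold-reverse x xs))
    (AllPairs.++⁺ (go rxs) ([] ∷ []) (All.map (_∷ []) (All-resp-↭ (↭-sym (↭-reverse xs)) rx)))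

Monotonic-reverse : ∀ {D} → Monotonic D → Monotonic (reverse D)
Monotonic-reverse (inj₁ inc) = inj₂ (Linked-reverse <-trans inc)
Monotonic-reverse (inj₂ dec) = inj₁ (Linked-reverse (λ p q → <-trans q p) dec)

Monotonic-reverse⁻ : ∀ {D} → Monotonic (reverse D) → Monotonic D
Monotonic-reverse⁻ {D} mono = subst Monotonic (reverse-involutive D) (Monotonic-reverse mono)

NoSandwich-reverse : NoSandwich d → NoSandwich (reverse d)
NoSandwich-reverse {d} ns e y≤p y≤q =
  ns (subst (_ ∷ _ ∷ [ _ ] ⊆_) (reverse-involutive d) (reverse⁺ e)) y≤q y≤p

reverse-ends : ∀ (a : ℕ) m b → reverse (a ∷ m ++ [ b ]) ≡ b ∷ reverse m ++ [ a ]
reverse-ends a m b = trans (unfold-reverse a (m ++ [ b ])) (cong (_∷ʳ a) (reverse-++ m [ b ]))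

range⇒distinct : xs ↭ range t k → AllPairs _≢_ xs
range⇒distinct {t = t} {k = k} p =
  Unique-resp-↭ (↭⇒↭ₛ (↭-sym p)) (AllPairs.map <⇒≢ (range-increasing t k))

ordered-ends : ∀ {rem} m → a < b → t + k ≡ n → NoSandwich (a ∷ m ++ [ b ]) →
               (a ∷ m ++ [ b ]) ++ x ∷ rem ↭ range t k →
               Choice n t (a ∷ m ++ [ b ]) x rem ⇔ Criterion a b t (a ∷ m ++ [ b ]) x rem
ordered-ends {a} {b} {t} {k} {n} {x} {rem} m a<b t+k≡n ns p = mk⇔ necessary sufficient
  where
  open Position n t k a b x m rem a<b t+k≡n (range⇒distinct p) ns p

distinct-ends : ∀ {rem} m → a ≢ b → t + k ≡ n → NoSandwich (a ∷ m ++ [ b ]) →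
                (a ∷ m ++ [ b ]) ++ x ∷ rem ↭ range t k →
                Choice n t (a ∷ m ++ [ b ]) x rem ⇔
                Criterion (a ⊓ b) (a ⊔ b) t (a ∷ m ++ [ b ]) x rem
distinct-ends {a} {b} {t} {k} {n} {x} {rem} m a≢b t+k≡n ns p with <-cmp a b
... | tri≈ _ a≡b _ = ⊥-elim (a≢b a≡b)
... | tri< a<b _ _
  rewrite m≤n⇒m⊓n≡m (<⇒≤ a<b) | m≤n⇒m⊔n≡n (<⇒≤ a<b) = ordered-ends m a<b t+k≡n ns p
-- The reflected deque has its smaller end on the left, and the criterion sees the deque only
-- through monotonicity, which reflection preserves.
... | tri> _ _ b<a
  rewrite m≥n⇒m⊓n≡n (<⇒≤ b<a) | m≥n⇒m⊔n≡m (<⇒≤ b<a) = mk⇔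
    (λ ch → Criterion-mono Monotonic-reverse⁻
       (Equivalence.to reversed (Choice-reverse ch)))
    (λ cr → subst (λ d → Choice n t d x rem) (reverse-involutive D)
       (Choice-reverse (Equivalence.from reversed (Criterion-mono Monotonic-reverse cr))))
  where
  D : List ℕ
  D = a ∷ m ++ [ b ]

  Criterion-mono : ∀ {E E′} → (Monotonic E → Monotonic E′) →
                   Criterion b a t E x rem → Criterion b a t E′ x rem
  Criterion-mono f (p , q , r , s , h) = p , q , r , s , λ ¬mono → h (¬mono ∘ f)

  reversed : Choice n t (reverse D) x rem ⇔ Criterion b a t (reverse D) x rem
  reversed = subst (λ d → Choice n t d x rem ⇔ Criterion b a t d x rem) (sym (reverse-ends a m b))
    (ordered-ends (reverse m) b<a t+k≡n
      (subst NoSandwich (reverse-ends a m b) (NoSandwich-reverse ns))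
      (subst (λ d → d ++ x ∷ rem ↭ range t k) (reverse-ends a m b)
        (↭-trans (Perm.++⁺ʳ (x ∷ rem) (↭-reverse D)) p)))

theorem10p2 : (n t x : ℕ) (D rem : List ℕ) →
    (oneTo t ++ D ++ x ∷ rem) ↭ oneTo n →
    ¬ Sandwich D →
    SubstantiveChoice n t D x rem ⇔ Conditions t D x rem
theorem10p2 n t x D rem p ¬sw = mk⇔
  (to D ns perm ∘ Equivalence.to SubstantiveChoice⇔Choice)
  (λ where (a , b , m , refl , cr) → Equivalence.from SubstantiveChoice⇔Choice
             (Equivalence.from (distinct-ends m (ends≢ a m b perm) t+k≡n ns perm) cr))
  where
  t≤n : t ≤ n
  t≤n = subst₂ _≤_ (length-applyUpTo suc t)
    (trans (sym (length-++ (oneTo t))) (trans (↭-length p) (length-applyUpTo suc n)))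
    (m≤m+n (length (oneTo t)) (length (D ++ x ∷ rem)))

  t+k≡n : t + (n ∸ t) ≡ n
  t+k≡n = m+[n∸m]≡n t≤n

  perm : D ++ x ∷ rem ↭ range t (n ∸ t)
  perm = ++-cancelˡ-↭ (oneTo t) (↭-trans p
        (↭-reflexive (trans (cong oneTo (sym t+k≡n)) (oneTo-split t (n ∸ t)))))

  ns : NoSandwich D
  ns = ¬Sandwich⇒NoSandwich (AllPairs-lookup (range⇒distinct perm) ∘ ++⁺ʳ (x ∷ rem)) ¬sw

  ends≢ : ∀ a m b → (a ∷ m ++ [ b ]) ++ x ∷ rem ↭ range t (n ∸ t) → a ≢ b
  ends≢ a m b perm = AllPairs-lookup (range⇒distinct perm)
    (refl ∷ ++⁺ʳ (x ∷ rem) (++⁺ˡ m ⊆-refl))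

  to : ∀ D → NoSandwich D → D ++ x ∷ rem ↭ range t (n ∸ t) → Choice n t D x rem → Conditions t D x rem
  -- Both placements yield the same deque; with a single element, below, they are mirror images.
  to [] _ _ ((_ , _ , s , ¬s) , _) = ⊥-elim (¬s s)
  to (d ∷ D) ns perm ch with initLast D | ch
  ... | [] | ((_ , _ , s , ¬s) , _) = ⊥-elim (¬s (Sorts-reverse s))
  ... | m ∷ʳ′ b | _ =
    d , b , m , refl , Equivalence.to (distinct-ends m (ends≢ d m b perm) t+k≡n ns perm) ch
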